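{- Let $F,F'$ be topological hyperfields, $F''$ a hyperfield, and $f:F\to F''$, $f':F'\to F''$ hyperfield morphisms. Let $*\in\{s,w\}$ and $M\in\operatorname{Gr}^*(r,F''^n)$. Suppose $H:F_0\times[0,1]\to F'_0$ is a hyperfield homotopy with $f'(H(x,t))=f(x)$ for all $x\in F$ and $t\in[0,1]$. Then $([\varphi],t)\mapsto[H_t\circ\varphi]$ defines a continuous map (homotopy) $$\operatorname{Real}^*_F(M)\times[0,1]\to\operatorname{Real}^*_{F'}(M).$$
   Context: Hyperfields. A hyperfield $(F,\odot,\boxplus,1,0)$ has the following data and axioms. - $\odot$ is a commutative multiplication and $\boxplus$ is a hyperaddition assigning to each $x,y$ a nonempty subset $x\boxplus y\subseteq F$ (extended to subsets by unions). - $\boxplus$ is commutative and associative, and $x\boxplus 0=\{x\}$. - Each $x$ has a unique $-x$ with $0\in x\boxplus(-x)$, and $x\in y\boxplus z \iff z\in x\boxplus(-y)$. - $(F\setminus\{0\},\odot,1)$ is an abelian group $F^\times$, $0\odot x=0$, and $x\odot(y\boxplus z)=(x\odot y)\boxplus(x\odot z)$. A homomorphism (morphism) $h$ satisfies $h(0)=0$, $h(1)=1$, $h(xy)=h(x)h(y)$ and $h(x\boxplus y)\subseteq h(x)\boxplus h(y)$. Topological hyperfields. A topological hyperfield is a hyperfield with a topology $T$ in which $F\setminus\{0\}$ is open, multiplication is continuous, and inversion on $F^\times$ is continuous. $F_0$ is $F$ with the 0-coarse topology, whose open sets are $F$ and all $U\in T$ with $0\notin U$. A hyperfield homotopy is a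 continuous $H:F\times[0,1]\to F'$ with each $H_t=H(\cdot,t)$ a hyperfield homomorphism. Grassmannians. A strong Grassmann–Plücker (GP) function of rank $r$ on $E=\{1,\dots,n\}$ is a function $\varphi:E^r\to F$ with the following properties. - $\varphi$ is not identically $0$. - $\varphi$ is alternating. - For all $(i_1,\dots,i_{r+1})\in E^{r+1}$ and $(j_1,\dots,j_{r-1})\in E^{r-1}$: $$0\in\boxplus_{k=1}^{r+1}(-1)^k\varphi(i_1,\dots,\widehat{i_k},\dots,i_{r+1})\odot\varphi(i_k,j_1,\dots,j_{r-1}).$$ A weak GP function is a function $\varphi:E^r\to F$ with the following properties. - $\varphi$ is nonzero and alternating. - Its support is the set of bases of a matroid. - The relation holds whenever $|\{i\}\setminus\{j\}|=3$. $\operatorname{Gr}^s(r,F^n)$ and $\operatorname{Gr}^w(r,F^n)$ are the sets of classes of strong, resp. weak, GP functions modulo $\varphi\sim\alpha\varphi$, $\alpha\in F^\times$. For topological $F$ they have the subspace topology of $(F^{E^r}\setminus\{0\})/F^\times$, which carries the product and quotient topologies. Realization spaces. A morphism $f$ induces $\operatorname{Gr}^*(f):[\varphi]\mapsto[f\circ\varphi]$. For $M\in\operatorname{Gr}^*(r,F''^n)$, the realization space $\operatorname{Real}^*_F(M)=\operatorname{Gr}^*(f)^{ -1}(M)\subseteq\operatorname{Gr}^*(r,F^n)$ has the subspace topology, computed with the given topology of $F$. -}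

module Defs where

open import Level using (Level; 0ℓ; _⊔_) renaming (suc to lsuc)
open import Algebra.Structures using (IsAbelianGroup; IsCommutativeMonoid)
open import Axiom.ExcludedMiddle using (ExcludedMiddle)
open import Data.Empty using (⊥-elim)
open import Data.Fin.Base using (Fin; toℕ)
open import Data.Fin.Subset as Subset using (Subset; ⁅_⁆; ∣_∣; _─_; _-_)
open import Data.List.Base using (List; []; _∷_; _++_)
open import Data.List.Relation.Unary.All using (All; []; _∷_)
import Data.List.Relation.Unary.All.Properties as All
open import Data.Nat.Base using (ℕ; zero; suc)
open import Data.Product.Base using (Σ; Σ-syntax; ∃-syntax; _×_; _,_; proj₁; proj₂; uncurry)
open import Data.Product.Relation.Binary.Pointwise.NonDependent using (×-setoid)
open import Data.Rational.Base as ℚ using (ℚ; 0ℚ; 1ℚ)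
import Data.Rational.Properties as ℚ
open import Data.Sum.Base using (_⊎_; inj₁; inj₂)
open import Data.Unit.Polymorphic.Base using (⊤; tt)
open import Data.Vec.Base using (Vec; []; _∷_; lookup; removeAt; _[_]≔_)
open import Data.Vec.Functional using (foldr)
open import Function.Base using (_∘_)
open import Function.Bundles using (Func; _⇔_; Equivalence)
open import Relation.Binary.Bundles using (Setoid)
open import Relation.Binary.Core using (Rel)
open import Relation.Binary.Definitions using (_Respects_)
open import Relation.Binary.PropositionalEquality.Core using (_≡_; _≢_; subst; sym)
open import Relation.Binary.Structures using (IsEquivalence)
import Relation.Binary.Construct.On as On
open import Relation.Nullary using (¬_; yes; no)
open import Relation.Unary using (Pred; _∈_; _∉_; _⊆_; _≐_; _∩_; ⋃; Satisfiable)

private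
  variable
    a b c c₁ c₂ e e₁ e₂ p ℓ : Level

------------------------------------------------------------------------
-- Setoids

subsetoid : (S : Setoid c e) → Pred (Setoid.Carrier S) p → Setoid (c ⊔ p) e
subsetoid S P = On.setoid S (proj₁ {B = P})

funSetoid : Set a → Setoid c e → Setoid (a ⊔ c) (a ⊔ e)
funSetoid J S = record
  { Carrier       = J → Carrier
  ; _≈_           = λ f g → ∀ j → f j ≈ g j
  ; isEquivalence = record
    { refl  = λ _ → refl
    ; sym   = λ p j → Setoid.sym S (p j)
    ; trans = λ p q j → trans (p j) (q j)
    }
  } where open Setoid S

quotientSetoid : (S : Setoid c e) {_∼_ : Rel (Setoid.Carrier S) e} →
                 IsEquivalence _∼_ → Setoid c e
quotientSetoid S eq = record { Carrier = Setoid.Carrier S ; isEquivalence = eq }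

------------------------------------------------------------------------
-- Topological spaces

-- A topology on a setoid, with subsets at level ℓ.  That the empty set
-- is open is the union over an empty index type.

record Topology (S : Setoid c e) (ℓ : Level) : Set (lsuc (c ⊔ e ⊔ lsuc ℓ)) where
  open Setoid S
  field
    IsOpen       : Pred Carrier ℓ → Set (c ⊔ e ⊔ lsuc ℓ)
    open-resp-≈  : ∀ {U} → IsOpen U → U Respects _≈_
    open-resp-≐  : ∀ {U V} → U ≐ V → IsOpen U → IsOpen V
    full-open    : IsOpen (λ _ → ⊤)
    ∩-open       : ∀ {U V} → IsOpen U → IsOpen V → IsOpen (U ∩ V)
    ⋃-open       : ∀ {I : Set ℓ} {U : I → Pred Carrier ℓ} →
                   (∀ i → IsOpen (U i)) → IsOpen (⋃ I U)

open Topology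

Continuous : {S : Setoid c₁ e₁} {T : Setoid c₂ e₂} → Topology S ℓ → Topology T ℓ →
             (Setoid.Carrier S → Setoid.Carrier T) → Set _
Continuous τ σ f = ∀ {V} → IsOpen σ V → IsOpen τ (V ∘ f)

infix 1 _⟶ᶜ_

record _⟶ᶜ_ {S : Setoid c₁ e₁} {T : Setoid c₂ e₂} (τ : Topology S ℓ) (σ : Topology T ℓ) :
            Set (c₁ ⊔ e₁ ⊔ c₂ ⊔ e₂ ⊔ lsuc ℓ) where
  field
    func       : Func S T
    continuous : Continuous τ σ (Func.to func)

  open Func func public using (to; cong)

subspace : {S : Setoid c e} → Topology S ℓ → (P : Pred (Setoid.Carrier S) p) →
           Topology (subsetoid S P) ℓ
subspace τ P = record
  { IsOpen      = λ U → ∃[ V ] (IsOpen τ V × U ≐ (V ∘ proj₁))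
  ; open-resp-≈ = λ (V , oV , U⊆V , V⊆U) x≈y x∈U →
                    V⊆U (open-resp-≈ τ oV x≈y (U⊆V x∈U))
  ; open-resp-≐ = λ (U⊆U′ , U′⊆U) (V , oV , U⊆V , V⊆U) →
                    V , oV , U⊆V ∘ U′⊆U , U⊆U′ ∘ V⊆U
  ; full-open   = (λ _ → ⊤) , full-open τ , (λ z → z) , (λ z → z)
  ; ∩-open      = λ (V , oV , U⊆V , V⊆U) (V′ , oV′ , U′⊆V′ , V′⊆U′) →
                    V ∩ V′ , ∩-open τ oV oV′
                    , (λ (u , u′) → U⊆V u , U′⊆V′ u′)
                    , (λ (v , v′) → V⊆U v , V′⊆U′ v′)
  ; ⋃-open      = λ os → ⋃ _ (λ i → proj₁ (os i))
                    , ⋃-open τ (λ i → proj₁ (proj₂ (os i)))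
                    , (λ (i , u) → i , proj₁ (proj₂ (proj₂ (os i))) u)
                    , (λ (i , v) → i , proj₂ (proj₂ (proj₂ (os i))) v)
  }

quotient : {S : Setoid c e} → Topology S ℓ →
           {_∼_ : Rel (Setoid.Carrier S) e} (eq : IsEquivalence _∼_) →
           Topology (quotientSetoid S eq) ℓ
quotient τ {_∼_} eq = record
  { IsOpen      = λ U → IsOpen τ U × U Respects _∼_
  ; open-resp-≈ = proj₂
  ; open-resp-≐ = λ (U⊆V , V⊆U) (oU , rU) →
                    open-resp-≐ τ (U⊆V , V⊆U) oU , λ x∼y → U⊆V ∘ rU x∼y ∘ V⊆U
  ; full-open   = full-open τ , λ _ u → u
  ; ∩-open      = λ (oU , rU) (oV , rV) →
                    ∩-open τ oU oV , λ x∼y (u , v) → rU x∼y u , rV x∼y v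
  ; ⋃-open      = λ os → ⋃-open τ (proj₁ ∘ os) , λ x∼y (i , u) → i , proj₂ (os i) x∼y u
  }

infixr 2 _×ₜ_

_×ₜ_ : {S : Setoid c₁ e₁} {T : Setoid c₂ e₂} →
       Topology S ℓ → Topology T ℓ → Topology (×-setoid S T) ℓ
_×ₜ_ {S = S} {T = T} τ σ = record
  { IsOpen      = λ W → ∀ {x y} → (x , y) ∈ W → Box W x y
  ; open-resp-≈ = λ o (x≈x′ , y≈y′) w →
                    let (U , V , oU , oV , x∈U , y∈V , sub) = o w
                    in sub (open-resp-≈ τ oU x≈x′ x∈U) (open-resp-≈ σ oV y≈y′ y∈V)
  ; open-resp-≐ = λ (W⊆W′ , W′⊆W) o w →
                    let (U , V , oU , oV , x∈U , y∈V , sub) = o (W′⊆W w)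
                    in U , V , oU , oV , x∈U , y∈V , λ u v → W⊆W′ (sub u v)
  ; full-open   = λ _ → (λ _ → ⊤) , (λ _ → ⊤) , full-open τ , full-open σ , tt , tt , λ _ _ → tt
  ; ∩-open      = λ o o′ (w , w′) →
                    let (U , V , oU , oV , x∈U , y∈V , sub) = o w
                        (U′ , V′ , oU′ , oV′ , x∈U′ , y∈V′ , sub′) = o′ w′
                    in U ∩ U′ , V ∩ V′ , ∩-open τ oU oU′ , ∩-open σ oV oV′
                       , (x∈U , x∈U′) , (y∈V , y∈V′)
                       , λ (u , u′) (v , v′) → sub u v , sub′ u′ v′
  ; ⋃-open      = λ os (i , w) →
                    let (U , V , oU , oV , x∈U , y∈V , sub) = os i w
                    in U , V , oU , oV , x∈U , y∈V , λ u v → i , sub u v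
  }
  where
  Box : Pred (Setoid.Carrier (×-setoid S T)) _ → Setoid.Carrier S → Setoid.Carrier T → Set _
  Box W x y = ∃[ U ] ∃[ V ] (IsOpen τ U × IsOpen σ V × x ∈ U × y ∈ V
                             × (∀ {x′ y′} → x′ ∈ U → y′ ∈ V → (x′ , y′) ∈ W))

-- The product topology on J → S: the basic open sets are finite
-- intersections of cylinders { x ∣ x j ∈ V } with V open.

power : (J : Set a) {S : Setoid c e} → Topology S ℓ → Topology (funSetoid J S) ℓ
power J {S} τ = record
  { IsOpen      = λ U → ∀ {x} → x ∈ U →
                    ∃[ cs ] (OpenCylinders cs × x ∈ Meet cs × Meet cs ⊆ U)
  ; open-resp-≈ = λ o x≈y u →
                    let (cs , os , x∈cs , sub) = o u
                    in sub (resp cs os x≈y x∈cs)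
  ; open-resp-≐ = λ (U⊆V , V⊆U) o v →
                    let (cs , os , x∈cs , sub) = o (V⊆U v)
                    in cs , os , x∈cs , U⊆V ∘ sub
  ; full-open   = λ _ → [] , [] , [] , λ _ → tt
  ; ∩-open      = λ o o′ (u , u′) →
                    let (cs , os , x∈cs , sub) = o u
                        (cs′ , os′ , x∈cs′ , sub′) = o′ u′
                    in cs ++ cs′ , All.++⁺ os os′ , All.++⁺ x∈cs x∈cs′
                       , λ m → sub (All.++⁻ˡ cs m) , sub′ (All.++⁻ʳ cs m)
  ; ⋃-open      = λ os (i , u) →
                    let (cs , ocs , x∈cs , sub) = os i u
                    in cs , ocs , x∈cs , λ m → i , sub m
  }
  where
  Cylinder = J × Pred (Setoid.Carrier S) _

  OpenCylinders : List Cylinder → Set _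
  OpenCylinders = All (IsOpen τ ∘ proj₂)

  Meet : List Cylinder → Pred (J → Setoid.Carrier S) _
  Meet cs x = All (λ (j , V) → x j ∈ V) cs

  resp : ∀ cs → OpenCylinders cs → Meet cs Respects Setoid._≈_ (funSetoid J S)
  resp []             []       x≈y []       = []
  resp ((j , _) ∷ cs) (o ∷ os) x≈y (v ∷ vs) = open-resp-≈ τ o (x≈y j) v ∷ resp cs os x≈y vs

------------------------------------------------------------------------
-- The unit interval

-- Real numbers as Dedekind cuts; `lower q` means q < x and `upper q`
-- means x < q.

record ℝ : Set₁ where
  field
    lower upper     : Pred ℚ 0ℓ
    lower-inhabited : Satisfiable lower
    upper-inhabited : Satisfiable upper
    lower-rounded   : ∀ {q} → lower q ⇔ (∃[ r ] (q ℚ.< r × lower r))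
    upper-rounded   : ∀ {r} → upper r ⇔ (∃[ q ] (q ℚ.< r × upper q))
    disjoint        : ∀ {q} → lower q → ¬ upper q
    located         : ∀ {q r} → q ℚ.< r → lower q ⊎ upper r

  lower-down : ∀ {q r} → q ℚ.≤ r → lower r → lower q
  lower-down q≤r l =
    let (s , r<s , l′) = Equivalence.to lower-rounded l
    in Equivalence.from lower-rounded (s , ℚ.≤-<-trans q≤r r<s , l′)

  upper-up : ∀ {q r} → q ℚ.≤ r → upper q → upper r
  upper-up q≤r u =
    let (s , s<q , u′) = Equivalence.to upper-rounded u
    in Equivalence.from upper-rounded (s , ℚ.<-≤-trans s<q q≤r , u′)

ℝ-setoid : Setoid (lsuc 0ℓ) 0ℓ
ℝ-setoid = record
  { Carrier       = ℝ
  ; _≈_           = λ x y → lower x ≐ lower y × upper x ≐ upper y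
  ; isEquivalence = record
    { refl  = ((λ z → z) , (λ z → z)) , ((λ z → z) , (λ z → z))
    ; sym   = λ ((f , g) , (h , k)) → (g , f) , (k , h)
    ; trans = λ ((f , g) , (h , k)) ((f′ , g′) , (h′ , k′)) →
                (f′ ∘ f , g ∘ g′) , (h′ ∘ h , k ∘ k′)
    }
  } where open ℝ

Between : ℚ → ℚ → Pred ℝ 0ℓ
Between q r x = ℝ.lower x q × ℝ.upper x r

-- A record so that its universe level can be fixed.

record IsOpenℝ {ℓ} (U : Pred ℝ ℓ) : Set (lsuc 0ℓ ⊔ lsuc ℓ) where
  constructor mkOpenℝ
  field
    interval : ∀ {x} → x ∈ U → ∃[ q ] ∃[ r ] (x ∈ Between q r × Between q r ⊆ U)

open IsOpenℝ

ℝ-topology : Topology ℝ-setoid ℓ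
ℝ-topology = record
  { IsOpen      = IsOpenℝ
  ; open-resp-≈ = λ o ((l , _) , (u , _)) x∈U →
                    let (_ , _ , (q<x , x<r) , sub) = interval o x∈U
                    in sub (l q<x , u x<r)
  ; open-resp-≐ = λ (U⊆V , V⊆U) o → mkOpenℝ λ v →
                    let (q , r , x∈qr , sub) = interval o (V⊆U v)
                    in q , r , x∈qr , U⊆V ∘ sub
  ; full-open   = mkOpenℝ λ {x} _ →
                    let (q , q<x) = ℝ.lower-inhabited x
                        (r , x<r) = ℝ.upper-inhabited x
                    in q , r , (q<x , x<r) , λ _ → tt
  ; ∩-open      = λ o o′ → mkOpenℝ λ {x} (u , u′) →
                    let (q  , r  , (q<x  , x<r)  , sub)  = interval o u
                        (q′ , r′ , (q′<x , x<r′) , sub′) = interval o′ u′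
                    in q ℚ.⊔ q′ , r ℚ.⊓ r′ , (lower-⊔ x q<x q′<x , upper-⊓ x x<r x<r′)
                       , λ {y} (l , h) →
                           sub  ( ℝ.lower-down y (ℚ.p≤p⊔q q q′) l
                                , ℝ.upper-up   y (ℚ.p⊓q≤p r r′) h)
                         , sub′ ( ℝ.lower-down y (ℚ.p≤q⊔p q q′) l
                                , ℝ.upper-up   y (ℚ.p⊓q≤q r r′) h)
  ; ⋃-open      = λ os → mkOpenℝ λ (i , u) →
                    let (q , r , x∈qr , sub) = interval (os i) u
                    in q , r , x∈qr , λ m → i , sub m
  }
  where
  lower-⊔ : ∀ x {q q′} → ℝ.lower x q → ℝ.lower x q′ → ℝ.lower x (q ℚ.⊔ q′)
  lower-⊔ x {q} {q′} l l′ with ℚ.⊔-sel q q′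
  ... | inj₁ eq = subst (ℝ.lower x) (sym eq) l
  ... | inj₂ eq = subst (ℝ.lower x) (sym eq) l′

  upper-⊓ : ∀ x {r r′} → ℝ.upper x r → ℝ.upper x r′ → ℝ.upper x (r ℚ.⊓ r′)
  upper-⊓ x {r} {r′} u u′ with ℚ.⊓-sel r r′
  ... | inj₁ eq = subst (ℝ.upper x) (sym eq) u
  ... | inj₂ eq = subst (ℝ.upper x) (sym eq) u′

-- 0 ≤ x ≤ 1, in the form: neither x < 0 nor 1 < x.

InUnit : Pred ℝ 0ℓ
InUnit x = ¬ ℝ.upper x 0ℚ × ¬ ℝ.lower x 1ℚ

[0,1] : Setoid (lsuc 0ℓ) 0ℓ
[0,1] = subsetoid ℝ-setoid InUnit

𝕀 : Topology [0,1] ℓ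
𝕀 = subspace ℝ-topology InUnit

------------------------------------------------------------------------
-- Hyperfields

record Hyperfield (ℓ : Level) : Set (lsuc ℓ) where
  infix  4 _≈_
  infixl 6 _⊞_ _⊞ˢ_
  infixl 7 _⊙_
  field
    Carrier : Set ℓ
    _≈_     : Rel Carrier ℓ
    _⊙_     : Carrier → Carrier → Carrier
    _⊞_     : Carrier → Carrier → Pred Carrier ℓ
    -_      : Carrier → Carrier
    0# 1#   : Carrier

  ｛_｝ : Carrier → Pred Carrier ℓ
  ｛ x ｝ y = x ≈ y

  _⊞ˢ_ : Pred Carrier ℓ → Pred Carrier ℓ → Pred Carrier ℓ
  (A ⊞ˢ B) z = ∃[ x ] ∃[ y ] (x ∈ A × y ∈ B × z ∈ x ⊞ y)

  _⊙ˢ_ : Carrier → Pred Carrier ℓ → Pred Carrier ℓ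
  (x ⊙ˢ A) z = ∃[ y ] (y ∈ A × z ≈ x ⊙ y)

  NonZero : Pred Carrier ℓ
  NonZero x = ¬ x ≈ 0#

  Units : Set ℓ
  Units = Σ Carrier NonZero

  field
    -- The monoid laws for arguments that are 0 follow from the axioms
    -- below by deciding x ≈ 0#.
    ⊙-isCommutativeMonoid : IsCommutativeMonoid _≈_ _⊙_ 1#
    zeroˡ                 : ∀ x → 0# ⊙ x ≈ 0#

    1-nonZero : NonZero 1#
    ⊙-nonZero : ∀ {x y} → NonZero x → NonZero y → NonZero (x ⊙ y)
    _⁻¹       : Units → Units

  _≈ˣ_ : Rel Units ℓ
  u ≈ˣ v = proj₁ u ≈ proj₁ v

  _⊙ˣ_ : Units → Units → Units
  (x , x≉0) ⊙ˣ (y , y≉0) = x ⊙ y , ⊙-nonZero x≉0 y≉0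

  1ˣ : Units
  1ˣ = 1# , 1-nonZero

  field
    Units-isAbelianGroup : IsAbelianGroup _≈ˣ_ _⊙ˣ_ 1ˣ _⁻¹

    ⊞-cong     : ∀ {x x′ y y′} → x ≈ x′ → y ≈ y′ → x ⊞ y ≐ x′ ⊞ y′
    ⊞-resp     : ∀ {x y} → (x ⊞ y) Respects _≈_
    ⊞-nonEmpty : ∀ x y → Satisfiable (x ⊞ y)
    ⊞-comm     : ∀ x y → x ⊞ y ≐ y ⊞ x
    ⊞-assoc    : ∀ x y z → (x ⊞ y) ⊞ˢ ｛ z ｝ ≐ ｛ x ｝ ⊞ˢ (y ⊞ z)
    ⊞-identity : ∀ x → x ⊞ 0# ≐ ｛ x ｝
    -‿inverse  : ∀ x → 0# ∈ x ⊞ (- x)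
    -‿unique   : ∀ {x y} → 0# ∈ x ⊞ y → y ≈ - x
    reversible : ∀ {x y z} → x ∈ y ⊞ z ⇔ z ∈ x ⊞ (- y)
    distribˡ   : ∀ x y z → x ⊙ˢ (y ⊞ z) ≐ (x ⊙ y) ⊞ (x ⊙ z)

  open IsCommutativeMonoid ⊙-isCommutativeMonoid public
    using (isEquivalence; refl; trans)
    renaming (sym to ≈-sym; ∙-cong to ⊙-cong; assoc to ⊙-assoc;
              comm to ⊙-comm; identityˡ to ⊙-identityˡ)
  open IsAbelianGroup Units-isAbelianGroup public
    using () renaming (inverseˡ to ⁻¹-inverseˡ)

  setoid : Setoid ℓ ℓ
  setoid = record { isEquivalence = isEquivalence }

  infixr 8 _^_

  _^_ : Carrier → ℕ → Carrier
  x ^ zero  = 1#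
  x ^ suc k = x ⊙ x ^ k

  ⊞-sum : ∀ {m} → (Fin m → Carrier) → Pred Carrier ℓ
  ⊞-sum = foldr (λ x A → ｛ x ｝ ⊞ˢ A) ｛ 0# ｝

module _ (F G : Hyperfield ℓ) where
  private
    module F = Hyperfield F
    module G = Hyperfield G

  record IsHyperfieldMorphism (h : F.Carrier → G.Carrier) : Set ℓ where
    field
      cong   : ∀ {x y} → x F.≈ y → h x G.≈ h y
      0-homo : h F.0# G.≈ G.0#
      1-homo : h F.1# G.≈ G.1#
      ⊙-homo : ∀ x y → h (x F.⊙ y) G.≈ h x G.⊙ h y
      ⊞-homo : ∀ {x y z} → z ∈ x F.⊞ y → h z ∈ h x G.⊞ h y

  record HyperfieldMorphism : Set ℓ where
    field
      to         : F.Carrier → G.Carrier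
      isMorphism : IsHyperfieldMorphism to

    open IsHyperfieldMorphism isMorphism public

record TopologicalHyperfield (ℓ : Level) : Set (lsuc (lsuc ℓ)) where
  field
    hyperfield : Hyperfield ℓ

  open Hyperfield hyperfield public

  field
    topology      : Topology setoid ℓ
    nonZero-open  : IsOpen topology NonZero
    ⊙-continuous  : Continuous (topology ×ₜ topology) topology (uncurry _⊙_)
    ⁻¹-continuous : Continuous (subspace topology NonZero) (subspace topology NonZero) _⁻¹

-- The 0-coarse topology.  Excluded middle is used only to see that a
-- union one of whose members may be the whole space is again open.

zeroCoarse : ExcludedMiddle ℓ → (F : TopologicalHyperfield ℓ) →
             Topology (TopologicalHyperfield.setoid F) ℓ
zeroCoarse {ℓ} em F = record
  { IsOpen      = Open₀
  ; open-resp-≈ = λ { (inj₁ all) _ _ → all _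
                    ; (inj₂ (o , _)) → open-resp-≈ topology o }
  ; open-resp-≐ = λ { (U⊆V , _) (inj₁ all) → inj₁ (λ x → U⊆V (all x))
                    ; (U⊆V , V⊆U) (inj₂ (o , 0∉U)) →
                        inj₂ (open-resp-≐ topology (U⊆V , V⊆U) o , 0∉U ∘ V⊆U) }
  ; full-open   = inj₁ (λ _ → tt)
  ; ∩-open      = inter
  ; ⋃-open      = union
  }
  where
  open TopologicalHyperfield F

  Open₀ : Pred Carrier ℓ → Set (lsuc ℓ)
  Open₀ U = (∀ x → x ∈ U) ⊎ (IsOpen topology U × 0# ∉ U)

  inter : ∀ {U V} → Open₀ U → Open₀ V → Open₀ (U ∩ V)
  inter (inj₁ all) (inj₁ all′)      = inj₁ (λ x → all x , all′ x)
  inter (inj₁ all) (inj₂ (o , 0∉V)) =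
    inj₂ (open-resp-≐ topology ((λ v → all _ , v) , proj₂) o , 0∉V ∘ proj₂)
  inter (inj₂ (o , 0∉U)) (inj₁ all) =
    inj₂ (open-resp-≐ topology ((λ u → u , all _) , proj₁) o , 0∉U ∘ proj₁)
  inter (inj₂ (o , 0∉U)) (inj₂ (o′ , _)) = inj₂ (∩-open topology o o′ , 0∉U ∘ proj₁)

  union : ∀ {I : Set ℓ} {U : I → Pred Carrier ℓ} → (∀ i → Open₀ (U i)) → Open₀ (⋃ I U)
  union {I} {U} os with em {∃[ i ] (∀ x → x ∈ U i)}
  ... | yes (i , all) = inj₁ (λ x → i , all x)
  ... | no  none      = inj₂ (⋃-open topology (proj₁ ∘ os′) , λ (i , 0∈U) → proj₂ (os′ i) 0∈U)
    where
    os′ : ∀ i → IsOpen topology (U i) × 0# ∉ U i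
    os′ i with os i
    ... | inj₁ all = ⊥-elim (none (i , all))
    ... | inj₂ o   = o

record HyperfieldHomotopy (F F′ : Hyperfield ℓ)
                          (τ : Topology (Hyperfield.setoid F) ℓ)
                          (τ′ : Topology (Hyperfield.setoid F′) ℓ) :
                          Set (lsuc 0ℓ ⊔ lsuc ℓ) where
  field
    map : τ ×ₜ 𝕀 ⟶ᶜ τ′

  at : Setoid.Carrier [0,1] → Hyperfield.Carrier F → Hyperfield.Carrier F′
  at t x = _⟶ᶜ_.to map (x , t)

  field
    isMorphism : ∀ t → IsHyperfieldMorphism F F′ (at t)

------------------------------------------------------------------------
-- Matroids and Grassmann–Plücker functions

record IsMatroidBases {n} (𝓑 : Pred (Subset n) ℓ) : Set ℓ where
  field
    nonEmpty : Satisfiable 𝓑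
    exchange : ∀ {B B′} → B ∈ 𝓑 → B′ ∈ 𝓑 → ∀ {x} → x Subset.∈ B ─ B′ →
               ∃[ y ] (y Subset.∈ B′ ─ B × (B - x) Subset.∪ ⁅ y ⁆ ∈ 𝓑)

entries : ∀ {n m} → Vec (Fin n) m → Subset n
entries []       = Subset.⊥
entries (x ∷ xs) = ⁅ x ⁆ Subset.∪ entries xs

swap : ∀ {n r} → Fin r → Fin r → Vec (Fin n) r → Vec (Fin n) r
swap i j x = (x [ i ]≔ lookup x j) [ j ]≔ lookup x i

module _ (F : Hyperfield ℓ) {n r : ℕ} where
  open Hyperfield F

  NotIdenticallyZero : Pred (Vec (Fin n) r → Carrier) ℓ
  NotIdenticallyZero φ = ¬ (∀ x → φ x ≈ 0#)

  record IsAlternating (φ : Vec (Fin n) r → Carrier) : Set ℓ where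
    field
      vanishing : ∀ x {i j} → i ≢ j → lookup x i ≡ lookup x j → φ x ≈ 0#
      antisym   : ∀ x {i j} → i ≢ j → φ (swap i j x) ≈ - φ x

  -- For alternating φ the entries of x in the support are distinct, so
  -- these subsets have r elements.

  Support : (Vec (Fin n) r → Carrier) → Pred (Subset n) ℓ
  Support φ B = ∃[ x ] (NonZero (φ x) × entries x ≡ B)

module _ (F : Hyperfield ℓ) {n : ℕ} where
  open Hyperfield F

  -- `toℕ k` counts from 0, so the sign of the k-th term (counted from 1)
  -- has exponent `suc (toℕ k)`.

  GPRelation : ∀ {d} → (Vec (Fin n) (suc d) → Carrier) →
               Vec (Fin n) (suc (suc d)) → Vec (Fin n) d → Set ℓ
  GPRelation φ i j =
    0# ∈ ⊞-sum (λ k → (- 1#) ^ suc (toℕ k) ⊙ (φ (removeAt i k) ⊙ φ (lookup i k ∷ j)))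

  -- For r = 0 there are no tuples (j₁ , … , j_{r-1}), hence no relations.

  AllGPRelations : ∀ r → Pred (Vec (Fin n) r → Carrier) ℓ
  AllGPRelations zero    φ = ⊤
  AllGPRelations (suc d) φ = ∀ i j → GPRelation φ i j

  ThreeTermGPRelations : ∀ r → Pred (Vec (Fin n) r → Carrier) ℓ
  ThreeTermGPRelations zero    φ = ⊤
  ThreeTermGPRelations (suc d) φ = ∀ i j → ∣ entries i ─ entries j ∣ ≡ 3 → GPRelation φ i j

module _ (F : Hyperfield ℓ) {n r : ℕ} where
  open Hyperfield F

  record IsStrongGP (φ : Vec (Fin n) r → Carrier) : Set ℓ where
    field
      nonZero     : NotIdenticallyZero F φ
      alternating : IsAlternating F φ
      relations   : AllGPRelations F r φ

  record IsWeakGP (φ : Vec (Fin n) r → Carrier) : Set ℓ where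
    field
      nonZero     : NotIdenticallyZero F φ
      alternating : IsAlternating F φ
      matroid     : IsMatroidBases (Support F φ)
      relations   : ThreeTermGPRelations F r φ

data Kind : Set where
  strong weak : Kind

IsGP : Kind → (F : Hyperfield ℓ) {n r : ℕ} → Pred (Vec (Fin n) r → Hyperfield.Carrier F) ℓ
IsGP strong F = IsStrongGP F
IsGP weak   F = IsWeakGP F

------------------------------------------------------------------------
-- Grassmannians and realization spaces

module _ (F : Hyperfield ℓ) (r n : ℕ) where
  open Hyperfield F

  NonZeroFunctions : Setoid ℓ ℓ
  NonZeroFunctions = subsetoid (funSetoid (Vec (Fin n) r) setoid) (NotIdenticallyZero F)

module _ (F : Hyperfield ℓ) {r n : ℕ} where
  open Hyperfield F

  infix 4 _∼_

  _∼_ : Rel (Vec (Fin n) r → Carrier) ℓ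
  φ ∼ ψ = Σ[ α ∈ Units ] (∀ x → ψ x ≈ proj₁ α ⊙ φ x)

  ∼-isEquivalence : IsEquivalence _∼_
  ∼-isEquivalence = record
    { refl  = 1ˣ , λ x → ≈-sym (⊙-identityˡ _)
    ; sym   = λ (α , p) → α ⁻¹ , λ x → ≈-sym
                (trans (⊙-cong refl (p x))
                (trans (≈-sym (⊙-assoc _ _ _))
                (trans (⊙-cong (⁻¹-inverseˡ α) refl) (⊙-identityˡ _))))
    ; trans = λ (α , p) (β , q) → β ⊙ˣ α , λ x →
                trans (q x) (trans (⊙-cong refl (p x)) (≈-sym (⊙-assoc _ _ _)))
    }

  ∼-isEquivalence₀ : IsEquivalence {A = Setoid.Carrier (NonZeroFunctions F r n)} (λ φ ψ → proj₁ φ ∼ proj₁ ψ)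
  ∼-isEquivalence₀ = On.isEquivalence proj₁ ∼-isEquivalence

-- Classes of GP functions are GP functions with ∼ as equality.  The
-- nesting (functions that are not identically 0, modulo scaling, then
-- the subset of GP functions) matches `Gr-topology`.

Gr : Kind → (F : Hyperfield ℓ) (r n : ℕ) → Setoid ℓ ℓ
Gr k F r n =
  subsetoid (quotientSetoid (NonZeroFunctions F r n) (∼-isEquivalence₀ F)) (IsGP k F ∘ proj₁)

-- A GP function representing a point of the Grassmannian.

rep : (k : Kind) (F : Hyperfield ℓ) {r n : ℕ} →
      Setoid.Carrier (Gr k F r n) → (Vec (Fin n) r → Hyperfield.Carrier F)
rep k F ((φ , _) , _) = φ

Gr-topology : (k : Kind) (F : TopologicalHyperfield ℓ) (r n : ℕ) →
              Topology (Gr k (TopologicalHyperfield.hyperfield F) r n) ℓ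
Gr-topology k F r n =
  subspace
    (quotient (subspace (power (Vec (Fin n) r) topology) (NotIdenticallyZero hyperfield))
              (∼-isEquivalence₀ hyperfield))
    (IsGP k hyperfield ∘ proj₁)
  where open TopologicalHyperfield F

module _ (k : Kind) (F : Hyperfield ℓ) {F″ : Hyperfield ℓ} (f : HyperfieldMorphism F F″)
         {r n : ℕ} (M : Setoid.Carrier (Gr k F″ r n)) where

  -- [ f ∘ φ ] = M

  Realizes : Pred (Setoid.Carrier (Gr k F r n)) ℓ
  Realizes φ = _∼_ F″ (HyperfieldMorphism.to f ∘ rep k F φ) (rep k F″ M)

  Real : Setoid ℓ ℓ
  Real = subsetoid (Gr k F r n) Realizes

Real-topology : (k : Kind) (F : TopologicalHyperfield ℓ) {F″ : Hyperfield ℓ}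
                (f : HyperfieldMorphism (TopologicalHyperfield.hyperfield F) F″)
                {r n : ℕ} (M : Setoid.Carrier (Gr k F″ r n)) →
                Topology (Real k (TopologicalHyperfield.hyperfield F) f M) ℓ
Real-topology k F f M =
  subspace (Gr-topology k F _ _) (Realizes k (TopologicalHyperfield.hyperfield F) f M)

{-# OPTIONS --safe #-}

-- A hyperfield morphism sends nonzero elements to nonzero elements, so every
-- GP function realizing M has the support of M.  Fix b in this support.  Each
-- class in Real(M) has the representative x ↦ φ x / φ b, which depends
-- continuously on φ.  A coordinate outside the support is constantly 0 and is
-- sent to 0 by every H_t; the remaining coordinates are nonzero, and away from
-- 0 the 0-coarse topology agrees with the given one.  Hence H acts
-- continuously on the normalized representatives.

module Submission where

open import Level using (Level; _⊔_)
open import Algebra.Bundles using (CommutativeMonoid)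
import Algebra.Properties.CommutativeSemigroup as CommutativeSemigroupProperties
open import Axiom.ExcludedMiddle using (ExcludedMiddle)
open import Data.Fin.Base using (Fin; zero; suc; toℕ)
open import Data.Fin.Subset using (Subset)
open import Data.List.Base using (List; []; _∷_)
open import Data.List.Relation.Unary.All using (All; []; _∷_)
open import Data.Nat.Base using (ℕ; zero; suc)
open import Data.Product.Base using (Σ-syntax; ∃-syntax; _×_; _,_; proj₁; proj₂)
open import Data.Sum.Base using (inj₁; inj₂)
open import Data.Unit.Polymorphic.Base using (⊤; tt)
open import Data.Vec.Base using (Vec; _∷_; lookup; removeAt)
open import Function.Base using (_∘_; id)
open import Relation.Binary.Bundles using (Setoid)
open import Relation.Binary.Structures using (IsEquivalence)
open import Relation.Nullary using (yes; no)
open import Relation.Nullary.Decidable.Core using (decidable-stable)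
open import Relation.Unary using (Pred; _∈_; _≐_; _∩_)
open import Defs
open Topology
open TopologicalHyperfield using (hyperfield)
open HyperfieldMorphism using (to)
open HyperfieldHomotopy using (at)

private
  variable
    ℓ : Level
    n r : ℕ

-- Transport of matroid bases and division by units.

IsMatroidBases-resp-≐ : {𝓑 𝓒 : Pred (Subset n) ℓ} → 𝓑 ≐ 𝓒 → IsMatroidBases 𝓑 → IsMatroidBases 𝓒
IsMatroidBases-resp-≐ (𝓑⊆𝓒 , 𝓒⊆𝓑) m = record
  { nonEmpty = let (B , B∈𝓑) = nonEmpty in B , 𝓑⊆𝓒 B∈𝓑
  ; exchange = λ B∈ B′∈ x∈ →
                 let (y , y∈ , ex) = exchange (𝓒⊆𝓑 B∈) (𝓒⊆𝓑 B′∈) x∈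
                 in y , y∈ , 𝓑⊆𝓒 ex
  }
  where open IsMatroidBases m

module HyperfieldProperties (F : Hyperfield ℓ) where
  open Hyperfield F
  private
    ⊙-commutativeMonoid : CommutativeMonoid ℓ ℓ
    ⊙-commutativeMonoid = record { isCommutativeMonoid = ⊙-isCommutativeMonoid }

    module ⊙ = CommutativeSemigroupProperties
      (CommutativeMonoid.commutativeSemigroup ⊙-commutativeMonoid)

  NonZero-resp : ∀ {x y} → x ≈ y → NonZero x → NonZero y
  NonZero-resp x≈y x≉0 y≈0 = x≉0 (trans x≈y y≈0)

  zeroʳ : ∀ x → x ⊙ 0# ≈ 0#
  zeroʳ x = trans (⊙-comm x 0#) (zeroˡ x)

  -‿cong : ∀ {x y} → x ≈ y → - x ≈ - y
  -‿cong {x} x≈y = -‿unique (proj₁ (⊞-cong x≈y refl) (-‿inverse x))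

  infixl 7 _÷_

  _÷_ : Carrier → Units → Carrier
  x ÷ u = x ⊙ proj₁ (u ⁻¹)

  ÷-⊙ : ∀ x u → x ≈ proj₁ u ⊙ (x ÷ u)
  ÷-⊙ x u = ≈-sym (trans (⊙.x∙yz≈y∙xz (proj₁ u) x (proj₁ (u ⁻¹)))
    (trans (⊙-cong refl (trans (⊙-comm _ _) (⁻¹-inverseˡ u))) (trans (⊙-comm _ _) (⊙-identityˡ x))))

  -- Multiply by the inverse of `u`. Together with `÷-⊙` this shows that a quotient does not depend
  -- on the proof of nonvanishing carried by its denominator.
  ÷-unique : ∀ {x q} u → x ≈ proj₁ u ⊙ q → q ≈ x ÷ u
  ÷-unique {x} {q} u x≈uq = ≈-sym (trans (⊙-cong x≈uq refl)
    (trans (⊙-comm _ _) (trans (≈-sym (⊙-assoc _ _ _))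
      (trans (⊙-cong (⁻¹-inverseˡ u) refl) (⊙-identityˡ q)))))

  -- With q = x / u, x′ ≈ α u q ≈ u′ q, so uniqueness applies. Thus ratios of coordinates are
  -- unchanged when a GP function is rescaled.
  ÷-scale : ∀ {x x′ α} {u u′ : Units} → x′ ≈ α ⊙ x → proj₁ u′ ≈ α ⊙ proj₁ u → x ÷ u ≈ x′ ÷ u′
  ÷-scale {x} {x′} {α} {u} {u′} x′≈αx u′≈αu = ÷-unique u′
    (trans x′≈αx (trans (⊙-cong refl (÷-⊙ x u)) (trans (≈-sym (⊙-assoc _ _ _))
      (⊙-cong (≈-sym u′≈αu) refl))))

  ÷-nonZero : ∀ {x} u → NonZero x → NonZero (x ÷ u)
  ÷-nonZero u x≉0 = ⊙-nonZero x≉0 (proj₂ (u ⁻¹))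

  ÷-zero : ∀ {x} u → x ≈ 0# → x ÷ u ≈ 0#
  ÷-zero u x≈0 = trans (⊙-cong x≈0 refl) (zeroˡ _)

-- Morphisms preserve supports and GP functions.

module MorphismProperties {F G : Hyperfield ℓ} {h : Hyperfield.Carrier F → Hyperfield.Carrier G}
                          (h-isMorphism : IsHyperfieldMorphism F G h) where
  private
    module F = Hyperfield F
    module G = Hyperfield G
  open HyperfieldProperties
  open IsHyperfieldMorphism h-isMorphism

  -- If h(x) were 0, then 1 = h(x⁻¹)h(x) would be 0.
  nonZero-homo : ∀ {x} → F.NonZero x → G.NonZero (h x)
  nonZero-homo {x} x≉0 hx≈0 = G.1-nonZero
    (G.trans (G.≈-sym 1-homo)
    (G.trans (cong (F.≈-sym (F.⁻¹-inverseˡ (x , x≉0))))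
    (G.trans (⊙-homo _ x)
    (G.trans (G.⊙-cong G.refl hx≈0) (zeroʳ G _)))))

  nonZero-homo⁻¹ : ∀ {x} → G.NonZero (h x) → F.NonZero x
  nonZero-homo⁻¹ hx≉0 x≈0 = hx≉0 (G.trans (cong x≈0) 0-homo)

  -- Applying `h` to 0 ∈ x ⊞ (-x) exhibits h(-x) as an additive inverse of h(x), and that inverse is
  -- unique.
  -‿homo : ∀ x → h (F.- x) G.≈ G.- h x
  -‿homo x = G.-‿unique (G.⊞-resp 0-homo (⊞-homo (F.-‿inverse x)))

  ^-homo : ∀ x k → h (x F.^ k) G.≈ h x G.^ k
  ^-homo x zero    = 1-homo
  ^-homo x (suc k) = G.trans (⊙-homo _ _) (G.⊙-cong G.refl (^-homo x k))

  -- Terms and total are matched only up to `≈`, so a GP relation can be pushed forward with `h`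
  -- already distributed over signs and products.
  ⊞-sum-homo : ∀ {m} {xs : Fin m → F.Carrier} {ys : Fin m → G.Carrier} {z w} →
               (∀ k → h (xs k) G.≈ ys k) → h z G.≈ w → z ∈ F.⊞-sum xs → w ∈ G.⊞-sum ys
  ⊞-sum-homo {zero}  xs≈ys z≈w 0≈z = G.trans (G.≈-sym 0-homo) (G.trans (cong 0≈z) z≈w)
  ⊞-sum-homo {suc m} xs≈ys z≈w (x , y , x₀≈x , y∈ , z∈) =
    h x , h y , G.trans (G.≈-sym (xs≈ys zero)) (cong x₀≈x)
    , ⊞-sum-homo (xs≈ys ∘ suc) G.refl y∈ , G.⊞-resp z≈w (⊞-homo z∈)

  notIdenticallyZero-homo : ExcludedMiddle ℓ → {φ : Vec (Fin n) r → F.Carrier} →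
                            NotIdenticallyZero F φ → NotIdenticallyZero G (h ∘ φ)
  notIdenticallyZero-homo em φ≉0 hφ≈0 =
    φ≉0 λ x → decidable-stable em λ φx≉0 → nonZero-homo φx≉0 (hφ≈0 x)

  alternating-homo : {φ : Vec (Fin n) r → F.Carrier} → IsAlternating F φ → IsAlternating G (h ∘ φ)
  alternating-homo alt = record
    { vanishing = λ x i≢j eq → G.trans (cong (vanishing x i≢j eq)) 0-homo
    ; antisym   = λ x i≢j → G.trans (cong (antisym x i≢j)) (-‿homo _)
    } where open IsAlternating alt

  Support-homo : (φ : Vec (Fin n) r → F.Carrier) → Support F φ ≐ Support G (h ∘ φ)
  Support-homo φ = (λ (x , nz , eq) → x , nonZero-homo nz , eq)
                 , (λ (x , nz , eq) → x , nonZero-homo⁻¹ nz , eq)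

  GPRelation-homo : ∀ {d} (φ : Vec (Fin n) (suc d) → F.Carrier) i j →
                    GPRelation F φ i j → GPRelation G (h ∘ φ) i j
  GPRelation-homo {d = d} φ i j = ⊞-sum-homo {m = suc (suc d)}
    (λ k → G.trans (⊙-homo _ _)
      (G.⊙-cong (sign (suc (toℕ k))) (⊙-homo (φ (removeAt i k)) (φ (lookup i k ∷ j))))) 0-homo
    where
    ^-cong : ∀ {x y} k → x G.≈ y → x G.^ k G.≈ y G.^ k
    ^-cong zero    x≈y = G.refl
    ^-cong (suc k) x≈y = G.⊙-cong x≈y (^-cong k x≈y)

    sign : ∀ k → h ((F.- F.1#) F.^ k) G.≈ (G.- G.1#) G.^ k
    sign k = G.trans (^-homo _ k) (^-cong k (G.trans (-‿homo _) (-‿cong G 1-homo)))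

  IsGP-homo : ExcludedMiddle ℓ → ∀ k {φ : Vec (Fin n) r → F.Carrier} → IsGP k F φ → IsGP k G (h ∘ φ)
  IsGP-homo em strong gp = record
    { nonZero     = notIdenticallyZero-homo em nonZero
    ; alternating = alternating-homo alternating
    ; relations   = all-relations _ _ relations
    }
    where
    open IsStrongGP gp
    -- Stated for every rank because `AllGPRelations` unfolds only after a case split on the rank.
    all-relations : ∀ r φ → AllGPRelations F {n} r φ → AllGPRelations G r (h ∘ φ)
    all-relations zero    φ _   = tt
    all-relations (suc d) φ rel = λ i j → GPRelation-homo φ i j (rel i j)
  IsGP-homo em weak gp = record
    { nonZero     = notIdenticallyZero-homo em nonZero
    ; alternating = alternating-homo alternating
    ; matroid     = IsMatroidBases-resp-≐ (Support-homo _) matroid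
    ; relations   = three-term-relations _ _ relations
    }
    where
    open IsWeakGP gp
    three-term-relations : ∀ r φ → ThreeTermGPRelations F {n} r φ → ThreeTermGPRelations G r (h ∘ φ)
    three-term-relations zero    φ _   = tt
    three-term-relations (suc d) φ rel = λ i j eq → GPRelation-homo φ i j (rel i j eq)

  ∼-homo : {φ ψ : Vec (Fin n) r → F.Carrier} → _∼_ F φ ψ → _∼_ G (h ∘ φ) (h ∘ ψ)
  ∼-homo ((α , α≉0) , ψ≈αφ) =
    (h α , nonZero-homo α≉0) , λ x → G.trans (cong (ψ≈αφ x)) (⊙-homo _ _)

-- Ratios of coordinates and the 0-coarse topology.

module _ (F : TopologicalHyperfield ℓ) where
  open TopologicalHyperfield F hiding (hyperfield)
  open HyperfieldProperties (hyperfield F)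

  -- Nonvanishing at `b` is part of the condition, so this is a set of arbitrary functions and can
  -- be open in the full product.
  RatioIn : ∀ {a} {A : Set a} → A → A → Pred Carrier ℓ → Pred (A → Carrier) ℓ
  RatioIn j b U ψ = Σ[ ψb≉0 ∈ NonZero (ψ b) ] ψ j ÷ (ψ b , ψb≉0) ∈ U

  RatioIn-open : ∀ {a} {A : Set a} (j b : A) {U} → IsOpen topology U →
                 IsOpen (power A topology) (RatioIn j b U)
  RatioIn-open j b {U} oU {ψ} (ψb≉0 , ψj÷ψb∈U) =
    let (U₁ , U₂ , oU₁ , oU₂ , ψj∈U₁ , ψb⁻¹∈U₂ , sub) = ⊙-continuous oU ψj÷ψb∈U
        (V , oV , pre⊆V , V⊆pre) = ⁻¹-continuous {U₂ ∘ proj₁} (U₂ , oU₂ , id , id)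
    -- `V` describes the preimage of `U₂` under inversion only on units; the third cylinder
    -- guarantees that the denominator is one.
    in (j , U₁) ∷ (b , V) ∷ (b , NonZero) ∷ []
       , oU₁ ∷ oV ∷ nonZero-open ∷ []
       , ψj∈U₁ ∷ pre⊆V {ψ b , ψb≉0} ψb⁻¹∈U₂ ∷ ψb≉0 ∷ []
       , λ { (u ∷ v ∷ nz ∷ []) → nz , sub u (V⊆pre {_ , nz} v) }

  zeroCoarse⇒open : ∀ (em : ExcludedMiddle ℓ) {U} → IsOpen (zeroCoarse em F) U → IsOpen topology U
  zeroCoarse⇒open em (inj₁ all)     = open-resp-≐ topology ((λ _ → all _) , (λ _ → tt)) (full-open topology)
  zeroCoarse⇒open em (inj₂ (o , _)) = o

-- Continuity of the homotopy on normalized coordinates.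

module Homotopy (em : ExcludedMiddle ℓ) (F F′ : TopologicalHyperfield ℓ)
                (H : HyperfieldHomotopy (hyperfield F) (hyperfield F′) (zeroCoarse em F) (zeroCoarse em F′))
                where
  private
    module F  = TopologicalHyperfield F
    module F′ = TopologicalHyperfield F′
    module H  = HyperfieldHomotopy H
    I = Setoid.Carrier [0,1]
    module Hₜ (t : I) where
      open MorphismProperties (H.isMorphism t) public
      open IsHyperfieldMorphism (H.isMorphism t) public
  open HyperfieldProperties F.hyperfield

  -- `V` may contain 0 and fail to be 0-coarsely open. Removing 0 from it repairs this and keeps the
  -- image of `x`, which is nonzero.
  continuous-at-nonZero : ∀ {V} → IsOpen F′.topology V → ∀ {x t} → F.NonZero x → at H t x ∈ V →
    ∃[ U ] ∃[ J ] (IsOpen F.topology U × IsOpen 𝕀 J × x ∈ U × t ∈ J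
                   × (∀ {y s} → y ∈ U → s ∈ J → at H s y ∈ V))
  continuous-at-nonZero oV {t = t} x≉0 Hx∈V =
    let (U , J , oU , oJ , x∈U , t∈J , sub) =
          _⟶ᶜ_.continuous H.map
            (inj₂ (∩-open F′.topology oV F′.nonZero-open , λ (_ , 0≉0) → 0≉0 F′.refl))
            (Hx∈V , Hₜ.nonZero-homo t x≉0)
    in U , J , zeroCoarse⇒open F em oU , oJ , x∈U , t∈J , λ u s → proj₁ (sub u s)

  module _ {a} {A : Set a} (b : A) (Z : Pred A ℓ) where

    HasZeros : Pred (A → F.Carrier) (a ⊔ ℓ)
    HasZeros φ = ∀ j → (j ∈ Z → φ j F.≈ F.0#) × (φ j F.≈ F.0# → j ∈ Z)

    -- The sets W are saturated because they constrain only ratios of values.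
    continuous-on-ratios : (cs : List (A × Pred F′.Carrier ℓ)) → All (IsOpen F′.topology ∘ proj₂) cs →
      ∀ {φ t} (φb≉0 : F.NonZero (φ b)) → HasZeros φ →
      All (λ (j , V) → at H t (φ j ÷ (φ b , φb≉0)) ∈ V) cs →
      ∃[ W ] ∃[ J ] (IsOpen (power A F.topology) W × IsOpen 𝕀 J × φ ∈ W × t ∈ J
        × (∀ {ψ ψ′} (α : F.Units) → (∀ x → ψ′ x F.≈ proj₁ α F.⊙ ψ x) → ψ ∈ W → ψ′ ∈ W)
        × (∀ {ψ s} (ψb≉0 : F.NonZero (ψ b)) → HasZeros ψ → ψ ∈ W → s ∈ J →
           All (λ (j , V) → at H s (ψ j ÷ (ψ b , ψb≉0)) ∈ V) cs))
    continuous-on-ratios [] [] φb≉0 zφ [] =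
      (λ _ → ⊤) , (λ _ → ⊤) , full-open (power A F.topology) , full-open 𝕀 , tt , tt
      , (λ _ _ _ → tt) , λ _ _ _ _ → []
    continuous-on-ratios ((j , V) ∷ cs) (oV ∷ os) {φ} {t} φb≉0 zφ (m ∷ ms)
      with continuous-on-ratios cs os φb≉0 zφ ms | em {j ∈ Z}
    -- The ratio at `j` is 0 for both functions and every time sends it to 0, so this cylinder
    -- imposes no new constraint.
    ... | W , J , oW , oJ , φ∈W , t∈J , sat , sub | yes j∈Z =
      W , J , oW , oJ , φ∈W , t∈J , sat
      , λ ψb≉0 zψ ψ∈W s∈J → open-resp-≈ F′.topology oV
          (F′.trans (vanish t zφ φb≉0) (F′.≈-sym (vanish _ zψ ψb≉0))) m
          ∷ sub ψb≉0 zψ ψ∈W s∈J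
      where
      vanish : ∀ s {ψ} → HasZeros ψ → (ψb≉0 : F.NonZero (ψ b)) → at H s (ψ j ÷ (ψ b , ψb≉0)) F′.≈ F′.0#
      vanish s zψ ψb≉0 = F′.trans (Hₜ.cong s (÷-zero (_ , ψb≉0) (proj₁ (zψ j) j∈Z))) (Hₜ.0-homo s)
    -- The ratio at `j` is nonzero, so continuity at nonzero points applies.
    ... | W , J , oW , oJ , φ∈W , t∈J , sat , sub | no j∉Z =
      let (U , K , oU , oK , q∈U , t∈K , sub′) =
            continuous-at-nonZero oV {t = t}
              (÷-nonZero (φ b , φb≉0) (j∉Z ∘ proj₂ (zφ j))) m
      in RatioIn F j b U ∩ W , K ∩ J , ∩-open (power A F.topology) (RatioIn-open F j b oU) oW , ∩-open 𝕀 oK oJ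
         , ((φb≉0 , q∈U) , φ∈W) , (t∈K , t∈J)
         , (λ α ψ′≈αψ ((ψb≉0 , q) , ψ∈W) →
              let ψ′b≉0 = NonZero-resp (F.≈-sym (ψ′≈αψ b)) (F.⊙-nonZero (proj₂ α) ψb≉0)
              in (ψ′b≉0 , open-resp-≈ F.topology oU
                            (÷-scale {u = _ , ψb≉0} {_ , ψ′b≉0} (ψ′≈αψ j) (ψ′≈αψ b)) q)
                 , sat α ψ′≈αψ ψ∈W)
         -- Membership in `RatioIn` carries its own proof that `ψ b` is nonzero; uniqueness of
         -- quotients reconciles it with the given one.
         , λ ψb≉0 zψ ((ψb≉0′ , q) , ψ∈W) (s∈K , s∈J) →
             sub′ (open-resp-≈ F.topology oU
                    (÷-unique (_ , ψb≉0) (÷-⊙ _ (_ , ψb≉0′))) q) s∈K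
             ∷ sub ψb≉0 zψ ψ∈W s∈J

  -- Passage to realization spaces.

  module _ {F″ : Hyperfield ℓ} (f : HyperfieldMorphism F.hyperfield F″)
           (f′ : HyperfieldMorphism F′.hyperfield F″)
           (k : Kind) {r n : ℕ} (M : Setoid.Carrier (Gr k F″ r n))
           (f′H≈f : ∀ x t → Hyperfield._≈_ F″ (to f′ (at H t x)) (to f x)) where
    private
      module F″ = Hyperfield F″
      module f where
        open HyperfieldMorphism f public
        open MorphismProperties isMorphism public
      RealM  = Setoid.Carrier (Real k F.hyperfield f M)
      RealM′ = Setoid.Carrier (Real k F′.hyperfield f′ M)
      μ = rep k F″ M
      b-witness : ∃[ x ] F″.NonZero (μ x)
      b-witness = decidable-stable em λ none →
        proj₂ (proj₁ M) λ x → decidable-stable em λ μx≉0 → none (x , μx≉0)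
      b = proj₁ b-witness
      Z : Pred (Vec (Fin n) r) ℓ
      Z x = μ x F″.≈ F″.0#

      repF : RealM → Vec (Fin n) r → F.Carrier
      repF φ = rep k F.hyperfield (proj₁ φ)

      -- μ is a unit multiple of f ∘ φ, and `f` preserves both zero and nonzero elements.
      hasZeros : ∀ φ → HasZeros b Z (repF φ)
      hasZeros (φ , (α , α≉0) , μ≈αfφ) j =
          (λ μj≈0 → decidable-stable em λ φj≉0 →
             F″.⊙-nonZero α≉0 (f.nonZero-homo φj≉0) (F″.trans (F″.≈-sym (μ≈αfφ j)) μj≈0))
        , λ φj≈0 → F″.trans (μ≈αfφ j) (F″.trans
            (F″.⊙-cong F″.refl (F″.trans (f.cong φj≈0) f.0-homo)) (HyperfieldProperties.zeroʳ F″ α))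

      b-nonZero : ∀ φ → F.NonZero (repF φ b)
      b-nonZero φ = proj₂ b-witness ∘ proj₂ (hasZeros φ b)

      -- Since f′ ∘ H_t agrees with `f`, the scalar `α` witnessing that φ realizes `M` also serves
      -- for its image.
      H-map : RealM × I → RealM′
      H-map ((((φ , φ≉0) , gp) , (α , μ≈αfφ)) , t) =
        (((at H t ∘ φ) , Hₜ.notIdenticallyZero-homo t em φ≉0) , Hₜ.IsGP-homo t em k gp)
        , α , λ x → F″.trans (μ≈αfφ x) (F″.⊙-cong F″.refl (F″.≈-sym (f′H≈f _ t)))

      module _ (φ : RealM) (t : I) where
        u : F.Units
        u = repF φ b , b-nonZero φ

        ν : Vec (Fin n) r → F.Carrier
        ν x = repF φ x ÷ u

        Hν∼Hφ : _∼_ F′.hyperfield (at H t ∘ ν) (at H t ∘ repF φ)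
        Hν∼Hφ = Hₜ.∼-homo t (u , λ x → ÷-⊙ _ u)

        Hν : Setoid.Carrier (NonZeroFunctions F′.hyperfield r n)
        Hν = at H t ∘ ν , λ Hν≈0 → Hₜ.nonZero-homo t (÷-nonZero u (b-nonZero φ)) (Hν≈0 b)

    real-map : Real-topology k F f M ×ₜ 𝕀 ⟶ᶜ Real-topology k F′ f′ M
    real-map = record
      { func = record
        { to   = H-map
        ; cong = λ { {φ , t} {ψ , s} (φ∼ψ , t≈s) →
            -- The scalar relating φ to ψ is pushed through H_t; congruence of `H` then replaces `t`
            -- by `s`.
            let (β , p) = Hₜ.∼-homo t φ∼ψ
            in β , λ x → F′.trans (F′.≈-sym (_⟶ᶜ_.cong H.map (F.refl , t≈s))) (p x) }
        }
      -- The pattern peels off the nested topologies: `V` is the trace of `V₁`, `V₁` that of the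
      -- scaling-invariant `V₂`, and `V₂` that of `V₃`, open in the product.
      ; continuous = λ { (V₁ , (V₂ , ((V₃ , oV₃ , V₂⊆V₃ , V₃⊆V₂) , satV₂) , V₁⊆V₂ , V₂⊆V₁) , V⊆V₁ , V₁⊆V)
                         {φ} {t} Hφ∈V →
          -- Scaling invariance of `V₂` replaces H_t ∘ φ by H_t ∘ ν, so the cylinders constrain
          -- normalized coordinates.
          let (cs , os , ms , cs⊆V₃) = oV₃ (V₂⊆V₃ {Hν φ t}
                (satV₂ (IsEquivalence.sym (∼-isEquivalence F′.hyperfield) (Hν∼Hφ φ t))
                  (V₁⊆V₂ (V⊆V₁ {H-map (φ , t)} Hφ∈V))))
              (W , J , oW , oJ , φ∈W , t∈J , sat , sub) =
                continuous-on-ratios b Z cs os {t = t} (b-nonZero φ) (hasZeros φ) ms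
          -- `sat` makes `W` descend to the quotient, and its traces then give an open set of the
          -- realization space.
          in W ∘ repF , J
             , (W ∘ proj₁ ∘ proj₁
                 , (W ∘ proj₁ , ((W , oW , id , id) , λ { (α , p) → sat α p })
                    , id , id)
                 , id , id)
             , oJ , φ∈W , t∈J
             , λ {ψ} {s} ψ∈W s∈J → V₁⊆V {H-map (ψ , s)} (V₂⊆V₁
                 (satV₂ (Hν∼Hφ ψ s) (V₃⊆V₂ {Hν ψ s}
                   (cs⊆V₃ (sub {s = s} (b-nonZero ψ) (hasZeros ψ) ψ∈W s∈J))))) }
      }

theorem5p3 : ∀ {ℓ : Level} (em : ExcludedMiddle ℓ)
    (F F′ : TopologicalHyperfield ℓ) (F″ : Hyperfield ℓ)
    (f : HyperfieldMorphism (hyperfield F) F″)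
    (f′ : HyperfieldMorphism (hyperfield F′) F″)
    (k : Kind) (r n : ℕ) (M : Setoid.Carrier (Gr k F″ r n))
    (H : HyperfieldHomotopy (hyperfield F) (hyperfield F′) (zeroCoarse em F) (zeroCoarse em F′)) →
    (∀ (x : TopologicalHyperfield.Carrier F) (t : Setoid.Carrier [0,1]) →
    Hyperfield._≈_ F″ (to f′ (at H t x)) (to f x)) →
    Σ[ G ∈ (Real-topology k F f M ×ₜ 𝕀 ⟶ᶜ Real-topology k F′ f′ M) ]
    (∀ (φ : Setoid.Carrier (Real k (hyperfield F) f M)) (t : Setoid.Carrier [0,1]) →
    _∼_ (hyperfield F′)
    (rep k (hyperfield F′) (proj₁ (_⟶ᶜ_.to G (φ , t))))
    (at H t ∘ rep k (hyperfield F) (proj₁ φ)))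
theorem5p3 em F F′ F″ f f′ k r n M H f′H≈f =
  Homotopy.real-map em F F′ H f f′ k M f′H≈f
  -- `H-map` composes the representative with H_t, so both sides are the same function.
  , λ φ t → IsEquivalence.refl (∼-isEquivalence (hyperfield F′))
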